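{- Let $p\ge2$ be an integer, $r\in\{0,\dots,p-1\}$, $f:\mathbb{Z}_p\to\mathbb{Z}_p$ a function, $g,h\in\mathbb{Z}_p[x]$ such that $\gcd(p,h(r)\,\%\,p)=1$ and $f(n)=g(n)/h(n)$ for all $n\in r+p\mathbb{Z}_p$, and $k\ge0$ an integer. Then: (1) $f$ is weakly $(p,r)$-suitable at $k$. (2) If $k\le1$, then $f$ is $(p,r)$-suitable at $k$. (3) If $k\ge2$, then $f$ is $(p,r)$-suitable at $k$ if and only if the polynomial $g-(f(r)\,\%\,p)\,h$ is $(p,r)$-suitable at $k$.
   Context: $p\ge2$ is an integer, not necessarily prime. $\mathbb{Z}_p=\varprojlim \mathbb{Z}/p^k\mathbb{Z}$; every $a\in\mathbb{Z}_p$ is uniquely $a=\sum_{i\ge0}a_ip^i$ with $a_i\in\{0,\dots,p-1\}$, and $a\,\%\,p:=a_0$. A function $f:\mathbb{Z}_p\to\mathbb{Z}_p$ is weakly $(p,r)$-suitable at $k$ if for all $m,n\in r+p\mathbb{Z}_p$: $m\equiv n\pmod{p^k}$ implies $f(m)-(f(m)\%p)\equiv f(n)-(f(n)\%p)\pmod{p^k}$; it is $(p,r)$-suitable at $k$ if this implication is an equivalence for all $m,n\in r+p\mathbb{Z}_p$. Polynomials in $\mathbb{Z}_p[x]$ are regarded as functions $\mathbb{Z}_p\to\mathbb{Z}_p$. -}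

module Defs where

open import Algebra.Bundles using (CommutativeRing)
import Algebra.Definitions.RawMagma as RawMagmaDefinitions
open import Data.Fin.Base using (Fin; toℕ)
open import Data.Integer.Base as ℤ using (ℤ; +_; -[1+_])
import Data.Integer.DivMod as ℤ
import Data.Integer.Divisibility.Signed as ℤ
import Data.Integer.Properties as ℤ
open import Data.Integer.Tactic.RingSolver using (solve-∀)
open import Data.List.Base using (List; []; _∷_; map)
open import Data.Nat.Base as ℕ using (ℕ; zero; suc; NonZero; NonTrivial; nonTrivial⇒nonZero)
import Data.Nat.Coprimality as Coprimality
import Data.Nat.DivMod as ℕ
open import Data.Nat.GCD using (gcd; module Bézout)
import Data.Nat.Properties as ℕ
open import Data.Product.Base using (_,_)
open import Function.Bundles using (Func; _⇔_)
open import Level using (0ℓ)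
open import Relation.Binary.Bundles using (Setoid)
open import Relation.Binary.PropositionalEquality
  using (_≡_; refl; sym; trans; cong; cong₂; subst)

infix 4 _≡_[modℤ_]

record _≡_[modℤ_] (a b : ℤ) (n : ℕ) : Set where
  constructor modℤ
  field
    n∣a-b : + n ℤ.∣ a ℤ.- b

open _≡_[modℤ_] public

modℤ-reflexive : ∀ {n a b} → a ≡ b → a ≡ b [modℤ n ]
modℤ-reflexive {n} {a} refl = modℤ (ℤ.divides (+ 0) (ℤ.+-inverseʳ a))

modℤ-refl : ∀ {n a} → a ≡ a [modℤ n ]
modℤ-refl = modℤ-reflexive refl

modℤ-sym : ∀ {n a b} → a ≡ b [modℤ n ] → b ≡ a [modℤ n ]
modℤ-sym {n} {a} {b} (modℤ e) = modℤ (subst (+ n ℤ.∣_) (lem a b) (ℤ.∣m⇒∣-m e))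
  where
  lem : ∀ a b → ℤ.- (a ℤ.- b) ≡ b ℤ.- a
  lem = solve-∀

modℤ-trans : ∀ {n a b c} → a ≡ b [modℤ n ] → b ≡ c [modℤ n ] → a ≡ c [modℤ n ]
modℤ-trans {n} {a} {b} {c} (modℤ e) (modℤ e′) =
  modℤ (subst (+ n ℤ.∣_) (lem a b c) (ℤ.∣m∣n⇒∣m+n e e′))
  where
  lem : ∀ a b c → (a ℤ.- b) ℤ.+ (b ℤ.- c) ≡ a ℤ.- c
  lem = solve-∀

modℤ-+ : ∀ {n a b c d} → a ≡ b [modℤ n ] → c ≡ d [modℤ n ] →
         a ℤ.+ c ≡ b ℤ.+ d [modℤ n ]
modℤ-+ {n} {a} {b} {c} {d} (modℤ e) (modℤ e′) =
  modℤ (subst (+ n ℤ.∣_) (lem a b c d) (ℤ.∣m∣n⇒∣m+n e e′))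
  where
  lem : ∀ a b c d → (a ℤ.- b) ℤ.+ (c ℤ.- d) ≡ (a ℤ.+ c) ℤ.- (b ℤ.+ d)
  lem = solve-∀

modℤ-neg : ∀ {n a b} → a ≡ b [modℤ n ] → ℤ.- a ≡ ℤ.- b [modℤ n ]
modℤ-neg {n} {a} {b} (modℤ e) = modℤ (subst (+ n ℤ.∣_) (lem a b) (ℤ.∣m⇒∣-m e))
  where
  lem : ∀ a b → ℤ.- (a ℤ.- b) ≡ ℤ.- a ℤ.- ℤ.- b
  lem = solve-∀

modℤ-* : ∀ {n a b c d} → a ≡ b [modℤ n ] → c ≡ d [modℤ n ] →
         a ℤ.* c ≡ b ℤ.* d [modℤ n ]
modℤ-* {n} {a} {b} {c} {d} (modℤ e) (modℤ e′) = modℤ (subst (+ n ℤ.∣_) (lem a b c d)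
  (ℤ.∣m∣n⇒∣m+n (ℤ.∣m⇒∣m*n c e) (ℤ.∣n⇒∣m*n b e′)))
  where
  lem : ∀ a b c d → (a ℤ.- b) ℤ.* c ℤ.+ b ℤ.* (c ℤ.- d) ≡ a ℤ.* c ℤ.- b ℤ.* d
  lem = solve-∀

modℤ-∣ : ∀ {m n a b} → + m ℤ.∣ + n → a ≡ b [modℤ n ] → a ≡ b [modℤ m ]
modℤ-∣ m∣n (modℤ e) = modℤ (ℤ.∣-trans m∣n e)

%ℕ-congruent : ∀ a n .{{_ : NonZero n}} → a ≡ + (a ℤ.%ℕ n) [modℤ n ]
%ℕ-congruent a n = modℤ (ℤ.divides (a ℤ./ℕ n)
  (trans (cong (ℤ._- + (a ℤ.%ℕ n)) (ℤ.a≡a%ℕn+[a/ℕn]*n a n))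
    (lem (+ (a ℤ.%ℕ n)) (a ℤ./ℕ n ℤ.* + n))))
  where
  lem : ∀ u v → (u ℤ.+ v) ℤ.- u ≡ v
  lem = solve-∀

%ℕ-cong : ∀ {a b} n .{{_ : NonZero n}} → a ≡ b [modℤ n ] → a ℤ.%ℕ n ≡ b ℤ.%ℕ n
%ℕ-cong {a} {b} n e = go _ _ (ℤ.n%ℕd<d a n) (ℤ.n%ℕd<d b n)
  (modℤ-trans (modℤ-sym (%ℕ-congruent a n)) (modℤ-trans e (%ℕ-congruent b n)))
  where
  shift : ∀ {i j} q → + i ℤ.- + j ≡ + q ℤ.* + n → i ≡ j ℕ.+ q ℕ.* n
  shift {i} {j} q eq = ℤ.+-injective (trans (lem (+ i) (+ j))
    (trans (cong (ℤ._+_ (+ j)) (trans eq (sym (ℤ.pos-* q n)))) (sym (ℤ.pos-+ j (q ℕ.* n)))))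
    where
    lem : ∀ u v → u ≡ v ℤ.+ (u ℤ.- v)
    lem = solve-∀

  reduce : ∀ {i j} q → i ℕ.< n → j ℕ.< n → i ≡ j ℕ.+ q ℕ.* n → i ≡ j
  reduce {i} {j} q i<n j<n eq = trans (sym (ℕ.m<n⇒m%n≡m i<n))
    (trans (cong (ℕ._% n) eq) (trans (ℕ.[m+kn]%n≡m%n j q n) (ℕ.m<n⇒m%n≡m j<n)))

  go : ∀ i j → i ℕ.< n → j ℕ.< n → + i ≡ + j [modℤ n ] → i ≡ j
  go i j i<n j<n (modℤ (ℤ.divides (+ q) eq)) = reduce q i<n j<n (shift q eq)
  go i j i<n j<n (modℤ (ℤ.divides -[1+ q ] eq)) =
    sym (reduce (suc q) j<n i<n (shift {j} {i} (suc q)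
    (trans (lem (+ i) (+ j)) (trans (cong ℤ.-_ eq) (ℤ.neg-distribˡ-* -[1+ q ] (+ n))))))
    where
    lem : ∀ u v → v ℤ.- u ≡ ℤ.- (u ℤ.- v)
    lem = solve-∀

module PAdic (p : ℕ) .{{_ : NonTrivial p}} where

  private instance
    p≢0 : NonZero p
    p≢0 = nonTrivial⇒nonZero p

  -- The component in ℤ/pᵏ is given by an integer representative; the
  -- equality _≈_ forgets the choice of representatives.
  record ℤₚ : Set where
    constructor mkℤₚ
    field
      residue  : ℕ → ℤ
      coherent : ∀ k → residue (suc k) ≡ residue k [modℤ p ℕ.^ k ]

  open ℤₚ public

  infix 4 _≈_

  record _≈_ (a b : ℤₚ) : Set where
    constructor mk≈
    field
      residue-≈ : ∀ k → residue a k ≡ residue b k [modℤ p ℕ.^ k ]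

  open _≈_ public

  ≈-reflexive : ∀ {a b} → (∀ k → residue a k ≡ residue b k) → a ≈ b
  ≈-reflexive e = mk≈ λ k → modℤ-reflexive (e k)

  fromℤ : ℤ → ℤₚ
  fromℤ z = mkℤₚ (λ _ → z) (λ _ → modℤ-refl)

  fromℕ : ℕ → ℤₚ
  fromℕ n = fromℤ (+ n)

  private
    add mul : ℤₚ → ℤₚ → ℤₚ
    add a b = mkℤₚ (λ k → residue a k ℤ.+ residue b k)
                   (λ k → modℤ-+ (coherent a k) (coherent b k))
    mul a b = mkℤₚ (λ k → residue a k ℤ.* residue b k)
                   (λ k → modℤ-* (coherent a k) (coherent b k))

    neg : ℤₚ → ℤₚ
    neg a = mkℤₚ (λ k → ℤ.- residue a k) (λ k → modℤ-neg (coherent a k))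

  ℤₚ-commutativeRing : CommutativeRing 0ℓ 0ℓ
  ℤₚ-commutativeRing = record
    { Carrier = ℤₚ
    ; _≈_ = _≈_
    ; _+_ = add
    ; _*_ = mul
    ; -_  = neg
    ; 0#  = fromℕ 0
    ; 1#  = fromℕ 1
    ; isCommutativeRing = record
      { isRing = record
        { +-isAbelianGroup = record
          { isGroup = record
            { isMonoid = record
              { isSemigroup = record
                { isMagma = record
                  { isEquivalence = record
                    { refl  = ≈-reflexive λ _ → refl
                    ; sym   = λ e → mk≈ λ k → modℤ-sym (residue-≈ e k)
                    ; trans = λ e e′ → mk≈ λ k →
                        modℤ-trans (residue-≈ e k) (residue-≈ e′ k)
                    }
                  ; ∙-cong = λ e e′ → mk≈ λ k →
                      modℤ-+ (residue-≈ e k) (residue-≈ e′ k)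
                  }
                ; assoc = λ a b c → ≈-reflexive λ k → ℤ.+-assoc (residue a k) (residue b k) (residue c k)
                }
              ; identity = (λ a → ≈-reflexive λ k → ℤ.+-identityˡ (residue a k))
                         , (λ a → ≈-reflexive λ k → ℤ.+-identityʳ (residue a k))
              }
            ; inverse = (λ a → ≈-reflexive λ k → ℤ.+-inverseˡ (residue a k))
                      , (λ a → ≈-reflexive λ k → ℤ.+-inverseʳ (residue a k))
            ; ⁻¹-cong = λ e → mk≈ λ k → modℤ-neg (residue-≈ e k)
            }
          ; comm = λ a b → ≈-reflexive λ k → ℤ.+-comm (residue a k) (residue b k)
          }
        ; *-cong = λ e e′ → mk≈ λ k →
            modℤ-* (residue-≈ e k) (residue-≈ e′ k)
        ; *-assoc = λ a b c → ≈-reflexive λ k → ℤ.*-assoc (residue a k) (residue b k) (residue c k)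
        ; *-identity = (λ a → ≈-reflexive λ k → ℤ.*-identityˡ (residue a k))
                     , (λ a → ≈-reflexive λ k → ℤ.*-identityʳ (residue a k))
        ; distrib = (λ a b c → ≈-reflexive λ k → ℤ.*-distribˡ-+ (residue a k) (residue b k) (residue c k))
                  , (λ a b c → ≈-reflexive λ k → ℤ.*-distribʳ-+ (residue a k) (residue b k) (residue c k))
        }
      ; *-comm = λ a b → ≈-reflexive λ k → ℤ.*-comm (residue a k) (residue b k)
      }
    }

  open CommutativeRing ℤₚ-commutativeRing public
    using (_+_; _*_; -_; _-_; 0#; 1#; setoid; *-rawMagma)

  open RawMagmaDefinitions *-rawMagma public using (_∣_)

  infix 4 _≡_[mod-p^_] _∈_+pℤₚ
  infixl 7 _%p

  _≡_[mod-p^_] : ℤₚ → ℤₚ → ℕ → Set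
  m ≡ n [mod-p^ k ] = fromℕ (p ℕ.^ k) ∣ m - n

  _∈_+pℤₚ : ℤₚ → Fin p → Set
  n ∈ r +pℤₚ = fromℕ p ∣ n - fromℕ (toℕ r)

  -- The digit a₀ of a = Σ aᵢ pⁱ is the representative in {0, …, p - 1}
  -- of the image of a in ℤ/p.
  _%p : ℤₚ → ℕ
  a %p = residue a 1 ℤ.%ℕ p

  -- c₀ ∷ c₁ ∷ … ∷ c_d ∷ [] is c₀ + c₁ x + … + c_d x^d.
  ℤₚ[x] : Set
  ℤₚ[x] = List ℤₚ

  infixl 6 _-ₓ_
  infixl 7 _·ₓ_

  _·ₓ_ : ℤₚ → ℤₚ[x] → ℤₚ[x]
  c ·ₓ g = map (c *_) g

  _-ₓ_ : ℤₚ[x] → ℤₚ[x] → ℤₚ[x]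
  g       -ₓ []      = g
  []      -ₓ h       = map -_ h
  (a ∷ g) -ₓ (b ∷ h) = (a - b) ∷ (g -ₓ h)

  eval : ℤₚ[x] → ℤₚ → ℤₚ
  eval []      x = 0#
  eval (c ∷ g) x = c + x * eval g x

  eval-residue : ∀ g {x y} k → residue x k ≡ residue y k [modℤ p ℕ.^ k ] →
                 residue (eval g x) k ≡ residue (eval g y) k [modℤ p ℕ.^ k ]
  eval-residue []      k e = modℤ-refl
  eval-residue (c ∷ g) {x} {y} k e =
    modℤ-+ {a = residue c k} modℤ-refl (modℤ-* e (eval-residue g {x} {y} k e))

  polyFunc : ℤₚ[x] → Func setoid setoid
  polyFunc g = record
    { to   = eval g
    ; cong = λ {x} {y} e → mk≈ λ k → eval-residue g {x} {y} k (residue-≈ e k)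
    }

  Coprime-p : ℤₚ → Set
  Coprime-p y = gcd p (y %p) ≡ 1

  module _ (y : ℤₚ) (c : Coprime-p y) where

    private
      digit-inverse : Bézout.Identity 1 p (y %p) → ℤ
      digit-inverse (Bézout.+- _ v _) = ℤ.- + v
      digit-inverse (Bézout.-+ _ v _) = + v

      digit-inverse-correct : ∀ b → + 1 ≡ digit-inverse b ℤ.* + (y %p) [modℤ p ]
      digit-inverse-correct (Bézout.+- u v eq) = modℤ (ℤ.divides (+ u)
        (trans (lem (+ v) (+ (y %p)))
          (trans (cong (ℤ._+_ (+ 1)) (sym (ℤ.pos-* v (y %p))))
            (trans (cong +_ eq) (ℤ.pos-* u p)))))
        where
        lem : ∀ v d → + 1 ℤ.- ℤ.- v ℤ.* d ≡ + 1 ℤ.+ v ℤ.* d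
        lem = solve-∀
      digit-inverse-correct (Bézout.-+ u v eq) = modℤ (ℤ.divides (ℤ.- + u)
        (trans (cong (ℤ._-_ (+ 1)) (trans (sym (ℤ.pos-* v (y %p)))
          (trans (cong +_ (sym eq)) (cong (ℤ._+_ (+ 1)) (ℤ.pos-* u p))))) (lem (+ u) (+ p))))
        where
        lem : ∀ u q → + 1 ℤ.- (+ 1 ℤ.+ u ℤ.* q) ≡ ℤ.- u ℤ.* q
        lem = solve-∀

      bézout : Bézout.Identity 1 p (y %p)
      bézout = Coprimality.coprime-Bézout (Coprimality.gcd≡1⇒coprime c)

      u : ℤ
      u = digit-inverse bézout

      residue-mod-p : ∀ k → residue y (suc k) ≡ + (y %p) [modℤ p ]
      residue-mod-p zero    = %ℕ-congruent (residue y 1) p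
      residue-mod-p (suc k) = modℤ-trans
        (modℤ-∣ (ℤ.divides (+ (p ℕ.^ k))
          (trans (ℤ.pos-* p (p ℕ.^ k)) (ℤ.*-comm (+ p) (+ (p ℕ.^ k)))))
          (coherent y (suc k)))
        (residue-mod-p k)

      u-correct : ∀ k → + 1 ≡ u ℤ.* residue y (suc k) [modℤ p ]
      u-correct k = modℤ-trans (digit-inverse-correct bézout)
        (modℤ-* {a = u} modℤ-refl (modℤ-sym (residue-mod-p k)))

      -- Lifting: 1 - y eₖ₊₁ = (1 - y eₖ)(1 - u y), with u an inverse of y
      -- modulo p.
      e : ℕ → ℤ
      e zero    = + 0
      e (suc k) = e k ℤ.+ u ℤ.* (+ 1 ℤ.- residue y (suc k) ℤ.* e k)

      e-correct : ∀ k → residue y k ℤ.* e k ≡ + 1 [modℤ p ℕ.^ k ]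
      e-step    : ∀ k → residue y (suc k) ℤ.* e k ≡ + 1 [modℤ p ℕ.^ k ]

      e-step k = modℤ-trans (modℤ-* (coherent y k) modℤ-refl) (e-correct k)

      e-correct zero    = modℤ (ℤ.divides a (sym (ℤ.*-identityʳ a)))
        where a = residue y 0 ℤ.* + 0 ℤ.- + 1
      e-correct (suc k) = modℤ (subst (+ (p ℕ.^ suc k) ℤ.∣_)
        (lem (residue y (suc k)) (e k) u)
        (product (n∣a-b (e-step k)) (n∣a-b (u-correct k))))
        where
        lem : ∀ y e u → (y ℤ.* e ℤ.- + 1) ℤ.* (+ 1 ℤ.- u ℤ.* y) ≡
              y ℤ.* (e ℤ.+ u ℤ.* (+ 1 ℤ.- y ℤ.* e)) ℤ.- + 1
        lem = solve-∀
        rearrange : ∀ s t P Q → (s ℤ.* P) ℤ.* (t ℤ.* Q) ≡ (s ℤ.* t) ℤ.* (Q ℤ.* P)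
        rearrange = solve-∀
        product : ∀ {a b} → + (p ℕ.^ k) ℤ.∣ a → + p ℤ.∣ b → + (p ℕ.^ suc k) ℤ.∣ a ℤ.* b
        product (ℤ.divides s refl) (ℤ.divides t refl) = ℤ.divides (s ℤ.* t)
          (trans (rearrange s t (+ (p ℕ.^ k)) (+ p))
            (cong ((s ℤ.* t) ℤ.*_) (sym (ℤ.pos-* p (p ℕ.^ k)))))

      e-coherent : ∀ k → e (suc k) ≡ e k [modℤ p ℕ.^ k ]
      e-coherent k = modℤ (subst (+ (p ℕ.^ k) ℤ.∣_) (lem (residue y (suc k)) (e k) u)
        (ℤ.∣n⇒∣m*n (ℤ.- u) (n∣a-b (e-step k))))
        where
        lem : ∀ y e u → ℤ.- u ℤ.* (y ℤ.* e ℤ.- + 1) ≡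
              (e ℤ.+ u ℤ.* (+ 1 ℤ.- y ℤ.* e)) ℤ.- e
        lem = solve-∀

    inverse : ℤₚ
    inverse = mkℤₚ e e-coherent

    *-inverse : y * inverse ≈ 1#
    *-inverse = mk≈ e-correct

  infixl 7 _/_⟨_⟩

  _/_⟨_⟩ : ℤₚ → (y : ℤₚ) → Coprime-p y → ℤₚ
  x / y ⟨ c ⟩ = x * inverse y c

  eval-%p : ∀ h {r n} → n ∈ r +pℤₚ → eval h n %p ≡ eval h (fromℕ (toℕ r)) %p
  eval-%p h {r} {n} (record { quotient = q ; equality = q*p≈n-r }) =
    %ℕ-cong p (subst (λ N → residue (eval h n) 1 ≡ residue (eval h r′) 1 [modℤ N ]) p¹
      (eval-residue h {n} {r′} 1 n≡r))
    where
    r′ = fromℕ (toℕ r)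
    p¹ = ℕ.^-identityʳ p
    n≡r : residue n 1 ≡ residue r′ 1 [modℤ p ℕ.^ 1 ]
    n≡r = modℤ (subst (+ (p ℕ.^ 1) ℤ.∣_)
      (lem (residue q 1 ℤ.* + p) (residue n 1 ℤ.- residue r′ 1))
      (ℤ.∣m∣n⇒∣m-n
        (ℤ.divides (residue q 1) (cong (λ N → residue q 1 ℤ.* + N) (sym p¹)))
        (n∣a-b (residue-≈ q*p≈n-r 1))))
      where
      lem : ∀ a b → a ℤ.- (a ℤ.- b) ≡ b
      lem = solve-∀

  coprime-on-class : ∀ h r → Coprime-p (eval h (fromℕ (toℕ r))) →
                     ∀ {n} → n ∈ r +pℤₚ → Coprime-p (eval h n)
  coprime-on-class h r c {n} n∈ = trans (cong (gcd p) (eval-%p h {r} {n} n∈)) c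

  dropDigit : ℤₚ → ℤₚ
  dropDigit a = a - fromℕ (a %p)

  WeaklySuitable : Fin p → Func setoid setoid → ℕ → Set
  WeaklySuitable r f k = ∀ m n → m ∈ r +pℤₚ → n ∈ r +pℤₚ →
    m ≡ n [mod-p^ k ] → dropDigit (to m) ≡ dropDigit (to n) [mod-p^ k ]
    where open Func f

  Suitable : Fin p → Func setoid setoid → ℕ → Set
  Suitable r f k = ∀ m n → m ∈ r +pℤₚ → n ∈ r +pℤₚ →
    m ≡ n [mod-p^ k ] ⇔ dropDigit (to m) ≡ dropDigit (to n) [mod-p^ k ]
    where open Func f

{-# OPTIONS --safe #-}

-- On the class r + pℤₚ a polynomial g satisfies g(m) − g(n) = (m − n) G(m, n), and the divided
-- difference G is constant modulo p there.  Clearing the units h(m), h(n), this gives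
-- f(m) ≡ f(n) mod pᵏ ⇔ pᵏ ∣ (m − n) S(m, n) with S = G h − g H, and likewise for
-- P = g − d h with S = G − d H, where d = f(r) % p.  In particular both functions have a constant
-- first digit, so dropping it is harmless.  For k ≥ 2 suitability at k says exactly that the
-- constant value of S is a non-zero-divisor modulo p (test m = r + pᵏ⁻¹ t against n = r), and since
-- g(r) ≡ d h(r) mod p the two constants differ by the unit h(r).
module Submission where

import Algebra.Definitions.RawMagma as RawMagmaDefinitions
open import Data.Fin.Base using (Fin; toℕ)
open import Data.Integer.Base as ℤ using (ℤ; +_)
import Data.Integer.Divisibility.Signed as ℤ
import Data.Integer.Properties as ℤ
open import Data.Integer.Tactic.RingSolver using (solve-∀)
open import Data.List.Base using ([]; _∷_; map)
open import Data.Nat.Base as ℕ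
  using (ℕ; zero; suc; _≤_; s≤s; z≤n; _≤′_; ≤′-refl; ≤′-step; NonZero; NonTrivial; nonTrivial⇒nonZero)
open import Data.Nat.GCD using (gcd)
import Data.Nat.Properties as ℕ
open import Data.Product.Base using (_×_; _,_)
open import Function.Base using (_∘_)
open import Function.Bundles using (Func; Equivalence; _⇔_; mk⇔)
open import Function.Construct.Composition using (_⇔-∘_)
open import Function.Construct.Symmetry using (⇔-sym)
open import Relation.Binary.PropositionalEquality
  using (_≡_; refl; sym; trans; cong; cong₂; subst; subst₂)
  renaming (setoid to ≡-setoid)
open import Defs

-- Here and in p^∣residue⇒p^∣ the result type is headed by a record, not by the synonym _⇔_ or _∣_,
-- since only then does Agda unify it with the goal before checking the arguments.
⇔-intro : {A B : Set} → (A → B) → (B → A) → Equivalence (≡-setoid A) (≡-setoid B)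
⇔-intro = mk⇔

-- Cancellation and regularity modulo an integer.

∣-modℤ : ∀ {n a b} → a ≡ b [modℤ n ] → + n ℤ.∣ b → + n ℤ.∣ a
∣-modℤ {n} {a} {b} (modℤ e) n∣b = subst (+ n ℤ.∣_) (lem a b) (ℤ.∣m∣n⇒∣m+n e n∣b)
  where
  lem : ∀ a b → (a ℤ.- b) ℤ.+ b ≡ a
  lem = solve-∀

modℤ-cancel-- : ∀ {n a b d e} → d ≡ e → a ℤ.- d ≡ b ℤ.- e [modℤ n ] ⇔ a ≡ b [modℤ n ]
modℤ-cancel-- {n} {a} {b} {d} refl = mk⇔
  (modℤ ∘ subst (+ n ℤ.∣_) (lem a b d) ∘ n∣a-b)
  (modℤ ∘ subst (+ n ℤ.∣_) (sym (lem a b d)) ∘ n∣a-b)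
  where
  lem : ∀ a b d → (a ℤ.- d) ℤ.- (b ℤ.- d) ≡ a ℤ.- b
  lem = solve-∀

unit-cancel-∣ : ∀ {n} u v x → u ℤ.* v ≡ + 1 [modℤ n ] → + n ℤ.∣ u ℤ.* x → + n ℤ.∣ x
unit-cancel-∣ {n} u v x (modℤ e) n∣ux = subst (+ n ℤ.∣_) (lem u v x)
  (ℤ.∣m∣n⇒∣m-n (ℤ.∣n⇒∣m*n v n∣ux) (ℤ.∣m⇒∣m*n x e))
  where
  lem : ∀ u v x → v ℤ.* (u ℤ.* x) ℤ.- (u ℤ.* v ℤ.- + 1) ℤ.* x ≡ x
  lem = solve-∀

-- The class of `a` is a non-zero-divisor in ℤ/n. As p may be composite, this is the right
-- substitute for "p does not divide `a`".
RegularMod : ℕ → ℤ → Set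
RegularMod n a = ∀ t → + n ℤ.∣ t ℤ.* a → + n ℤ.∣ t

RegularMod-cong : ∀ {n a b} → a ≡ b [modℤ n ] → RegularMod n a → RegularMod n b
RegularMod-cong e reg t n∣tb = reg t (∣-modℤ (modℤ-* {a = t} modℤ-refl e) n∣tb)

RegularMod-unit : ∀ {n} u v a → u ℤ.* v ≡ + 1 [modℤ n ] →
                  RegularMod n (u ℤ.* a) ⇔ RegularMod n a
RegularMod-unit {n} u v a e = mk⇔ cancel scale
  where
  lem : ∀ u t a → u ℤ.* (t ℤ.* a) ≡ t ℤ.* (u ℤ.* a)
  lem = solve-∀

  cancel : RegularMod n (u ℤ.* a) → RegularMod n a
  cancel reg t n∣ta = reg t (subst (+ n ℤ.∣_) (lem u t a) (ℤ.∣n⇒∣m*n u n∣ta))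

  scale : RegularMod n a → RegularMod n (u ℤ.* a)
  scale reg t n∣tua = reg t (unit-cancel-∣ u v (t ℤ.* a) e
    (subst (+ n ℤ.∣_) (sym (lem u t a)) n∣tua))

-- Divisibility by powers of p.

module _ (p : ℕ) .{{_ : NonZero p}} where

  private
    pos-^-suc : ∀ k → + (p ℕ.^ suc k) ≡ + (p ℕ.^ k) ℤ.* + p
    pos-^-suc k = trans (ℤ.pos-* p (p ℕ.^ k)) (ℤ.*-comm (+ p) (+ (p ℕ.^ k)))

  p∣p^ : ∀ {k} → 1 ≤ k → + p ℤ.∣ + (p ℕ.^ k)
  p∣p^ {suc k} _ = ℤ.divides (+ (p ℕ.^ k)) (pos-^-suc k)

  ∣⇒^-suc∣ : ∀ k {x} → + p ℤ.∣ x → + (p ℕ.^ suc k) ℤ.∣ + (p ℕ.^ k) ℤ.* x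
  ∣⇒^-suc∣ k {x} p∣x = subst (ℤ._∣ + (p ℕ.^ k) ℤ.* x) (sym (pos-^-suc k)) (ℤ.*-monoʳ-∣ (+ (p ℕ.^ k)) p∣x)

  ^-suc∣⇒∣ : ∀ k {x} → + (p ℕ.^ suc k) ℤ.∣ + (p ℕ.^ k) ℤ.* x → + p ℤ.∣ x
  ^-suc∣⇒∣ k {x} d = ℤ.*-cancelˡ-∣ (+ (p ℕ.^ k)) {{ℕ.m^n≢0 p k}}
    (subst (ℤ._∣ + (p ℕ.^ k) ℤ.* x) (pos-^-suc k) d)

  -- Factors of p are peeled off one at a time. By induction x = y pᵏ; cancelling pᵏ in pᵏ⁺¹ ∣ y pᵏ
  -- a leaves p ∣ y a, and regularity gives p ∣ y.
  RegularMod-cancel-^ : ∀ {a} → RegularMod p a →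
                        ∀ k x → + (p ℕ.^ k) ℤ.∣ x ℤ.* a → + (p ℕ.^ k) ℤ.∣ x
  RegularMod-cancel-^ reg zero    x _ = ℤ.divides x (sym (ℤ.*-identityʳ x))
  RegularMod-cancel-^ {a} reg (suc k) x d
    with RegularMod-cancel-^ reg k x (ℤ.∣-trans (ℤ.divides (+ p) (ℤ.pos-* p (p ℕ.^ k))) d)
  ... | ℤ.divides y refl = subst (+ (p ℕ.^ suc k) ℤ.∣_) (ℤ.*-comm (+ (p ℕ.^ k)) y)
    (∣⇒^-suc∣ k (reg y (^-suc∣⇒∣ k (subst (+ (p ℕ.^ suc k) ℤ.∣_) (lem y (+ (p ℕ.^ k)) a) d))))
    where
    lem : ∀ y q a → (y ℤ.* q) ℤ.* a ≡ q ℤ.* (y ℤ.* a)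
    lem = solve-∀

module _ {p : ℕ} .{{_ : NonTrivial p}} where
  open PAdic p

  private instance
    p≢0 : NonZero p
    p≢0 = nonTrivial⇒nonZero p

  -- Divisibility in ℤₚ read off on residues.

  residue-≤ : ∀ a {i k} → i ≤ k → residue a k ≡ residue a i [modℤ p ℕ.^ i ]
  residue-≤ a {i} = go ∘ ℕ.≤⇒≤′
    where
    go : ∀ {k} → i ≤′ k → residue a k ≡ residue a i [modℤ p ℕ.^ i ]
    go ≤′-refl = modℤ-refl
    go (≤′-step {k} i≤k) = modℤ-trans (modℤ-∣ (p^i∣p^ (ℕ.≤′⇒≤ i≤k)) (coherent a k)) (go i≤k)
      where
      p^i∣p^ : i ≤ k → + (p ℕ.^ i) ℤ.∣ + (p ℕ.^ k)
      p^i∣p^ i≤k = ℤ.divides (+ (p ℕ.^ (k ℕ.∸ i)))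
        (trans (cong (+_ ∘ (p ℕ.^_)) (sym (ℕ.m∸n+n≡m i≤k)))
          (trans (cong +_ (ℕ.^-distribˡ-+-* p (k ℕ.∸ i) i)) (ℤ.pos-* (p ℕ.^ (k ℕ.∸ i)) (p ℕ.^ i))))

  residue-%p : ∀ a {k} → 1 ≤ k → residue a k ≡ + (a %p) [modℤ p ]
  residue-%p a 1≤k = modℤ-trans
    (subst (residue a _ ≡ residue a 1 [modℤ_]) (ℕ.^-identityʳ p) (residue-≤ a 1≤k))
    (%ℕ-congruent (residue a 1) p)

  ∣⇒∣residue : ∀ {n a k} → + n ℤ.∣ + (p ℕ.^ k) → fromℕ n ∣ a → + n ℤ.∣ residue a k
  ∣⇒∣residue {n} {a} {k} n∣p^k record { quotient = q ; equality = e } =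
    ∣-modℤ (modℤ-∣ n∣p^k (modℤ-sym (residue-≈ e k))) (ℤ.divides (residue q k) refl)

  p^∣⇒p^∣residue : ∀ k {a} → fromℕ (p ℕ.^ k) ∣ a → + (p ℕ.^ k) ℤ.∣ residue a k
  p^∣⇒p^∣residue k {a} = ∣⇒∣residue {p ℕ.^ k} {a} ℤ.∣-refl

  -- The quotient has j-th residue a₍ⱼ₊ₖ₎ / pᵏ: dividing by pᵏ costs k digits of precision.
  p^∣residue⇒p^∣ : ∀ {k a} → + (p ℕ.^ k) ℤ.∣ residue a k →
    RawMagmaDefinitions._∣ʳ_ *-rawMagma (fromℕ (p ℕ.^ k)) a
  p^∣residue⇒p^∣ {k} {a} d = record
    { quotient = mkℤₚ quo quo-coherent
    ; equality = mk≈ λ j → modℤ-trans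
        (modℤ-reflexive (sym (ℤ._∣_.equality (div j)))) (residue-≤ a (ℕ.m≤m+n j k))
    }
    where
    div : ∀ j → + (p ℕ.^ k) ℤ.∣ residue a (j ℕ.+ k)
    div j = ∣-modℤ (residue-≤ a (ℕ.m≤n+m k j)) d

    quo : ℕ → ℤ
    quo j = ℤ._∣_.quotient (div j)

    lem : ∀ x y q → x ℤ.* q ℤ.- y ℤ.* q ≡ (x ℤ.- y) ℤ.* q
    lem = solve-∀

    quo-coherent : ∀ j → quo (suc j) ≡ quo j [modℤ p ℕ.^ j ]
    quo-coherent j = modℤ (ℤ.*-cancelʳ-∣ (+ (p ℕ.^ k)) {{ℕ.m^n≢0 p k}}
      (subst₂ ℤ._∣_
        (trans (cong +_ (ℕ.^-distribˡ-+-* p j k)) (ℤ.pos-* (p ℕ.^ j) (p ℕ.^ k)))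
        (trans (cong₂ ℤ._-_ (ℤ._∣_.equality (div (suc j))) (ℤ._∣_.equality (div j)))
          (lem (quo (suc j)) (quo j) (+ (p ℕ.^ k))))
        (n∣a-b (coherent a (j ℕ.+ k)))))

  -- Divided differences of polynomials.

  slope : ℤₚ[x] → ℤₚ → ℤₚ → ℤₚ
  slope []      m n = 0#
  slope (c ∷ g) m n = eval g m + n * slope g m n

  -- Induction on `g`, using m x - n y = (m - n) x + n (x - y). Being free of division,
  -- `slope g m n` also makes sense at m = n, where it is the derivative.
  eval-slope : ∀ g m n k → residue (eval g m) k ℤ.- residue (eval g n) k ≡
               (residue m k ℤ.- residue n k) ℤ.* residue (slope g m n) k
  eval-slope []      m n k = sym (ℤ.*-zeroʳ (residue m k ℤ.- residue n k))
  eval-slope (c ∷ g) m n k =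
    trans (lem₁ (residue c k) (residue m k) (residue n k) (residue (eval g m) k) (residue (eval g n) k))
      (trans (cong (λ d → (residue m k ℤ.- residue n k) ℤ.* residue (eval g m) k ℤ.+ residue n k ℤ.* d)
                   (eval-slope g m n k))
        (lem₂ (residue m k) (residue n k) (residue (eval g m) k) (residue (slope g m n) k)))
    where
    lem₁ : ∀ c m n x y → (c ℤ.+ m ℤ.* x) ℤ.- (c ℤ.+ n ℤ.* y) ≡ (m ℤ.- n) ℤ.* x ℤ.+ n ℤ.* (x ℤ.- y)
    lem₁ = solve-∀
    lem₂ : ∀ m n x s → (m ℤ.- n) ℤ.* x ℤ.+ n ℤ.* ((m ℤ.- n) ℤ.* s) ≡ (m ℤ.- n) ℤ.* (x ℤ.+ n ℤ.* s)
    lem₂ = solve-∀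

  -- The modulus `N` is independent of the level `k`: below, residues at level `k` are compared
  -- modulo p, while `eval-residue` compares them modulo pᵏ.
  eval-modℤ : ∀ g m n k {N} → residue m k ≡ residue n k [modℤ N ] →
              residue (eval g m) k ≡ residue (eval g n) k [modℤ N ]
  eval-modℤ g m n k {N} (modℤ e) = modℤ (subst (+ N ℤ.∣_) (sym (eval-slope g m n k))
    (ℤ.∣m⇒∣m*n (residue (slope g m n) k) e))

  slope-modℤ : ∀ g m n m′ n′ k {N} →
    residue m k ≡ residue m′ k [modℤ N ] → residue n k ≡ residue n′ k [modℤ N ] →
    residue (slope g m n) k ≡ residue (slope g m′ n′) k [modℤ N ]
  slope-modℤ []      m n m′ n′ k e e′ = modℤ-refl
  slope-modℤ (c ∷ g) m n m′ n′ k e e′ =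
    modℤ-+ (eval-modℤ g m m′ k e) (modℤ-* e′ (slope-modℤ g m n m′ n′ k e e′))

  -- Only the effect of `μ` on residues enters, so that both scaling and negation, the latter with
  -- `c` = -1, are instances.
  eval-map : ∀ c {μ k} → (∀ b → residue (μ b) k ≡ c ℤ.* residue b k) → ∀ h x →
             residue (eval (map μ h) x) k ≡ c ℤ.* residue (eval h x) k
  eval-map c         μ≡ []      x = sym (ℤ.*-zeroʳ c)
  eval-map c {μ} {k} μ≡ (b ∷ h) x =
    trans (cong₂ (λ y z → y ℤ.+ residue x k ℤ.* z) (μ≡ b) (eval-map c {μ} {k} μ≡ h x))
      (lem c (residue b k) (residue x k) (residue (eval h x) k))
    where
    lem : ∀ c b x y → c ℤ.* b ℤ.+ x ℤ.* (c ℤ.* y) ≡ c ℤ.* (b ℤ.+ x ℤ.* y)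
    lem = solve-∀

  eval-ₓ : ∀ g h x k → residue (eval (g -ₓ h) x) k ≡ residue (eval g x) k ℤ.- residue (eval h x) k
  eval-ₓ g       []      x k = sym (ℤ.+-identityʳ (residue (eval g x) k))
  eval-ₓ []      (b ∷ h) x k =
    trans (eval-map ℤ.-1ℤ {μ = -_} (λ a → sym (ℤ.-1*i≡-i (residue a k))) (b ∷ h) x)
      (trans (ℤ.-1*i≡-i H) (sym (ℤ.+-identityˡ (ℤ.- H))))
    where
    H = residue (eval (b ∷ h) x) k
  eval-ₓ (a ∷ g) (b ∷ h) x k =
    trans (cong (λ y → (residue a k ℤ.- residue b k) ℤ.+ residue x k ℤ.* y) (eval-ₓ g h x k))
      (lem (residue a k) (residue b k) (residue x k) (residue (eval g x) k) (residue (eval h x) k))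
    where
    lem : ∀ a b x y z → (a ℤ.- b) ℤ.+ x ℤ.* (y ℤ.- z) ≡ (a ℤ.+ x ℤ.* y) ℤ.- (b ℤ.+ x ℤ.* z)
    lem = solve-∀

  -- The divided difference of g - c h, split by linearity so that it can be compared with the slope
  -- of g / h.
  linear-slope : ℕ → ℤₚ[x] → ℤₚ[x] → ℤₚ → ℤₚ → ℤₚ
  linear-slope c g h m n = slope g m n - fromℕ c * slope h m n

  -- The scaling c ·ₓ_ is map (fromℕ c *_).  With the coefficient map as a variable μ, Agda can read
  -- it off a goal instead of comparing coherence proofs of products.
  eval-linear-slope : ∀ c g h {μ} → (∀ b k → residue (μ b) k ≡ + c ℤ.* residue b k) → ∀ m n k →
    residue (eval (g -ₓ map μ h) m) k ℤ.- residue (eval (g -ₓ map μ h) n) k ≡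
    (residue m k ℤ.- residue n k) ℤ.* residue (linear-slope c g h m n) k
  eval-linear-slope c g h {μ} μ≡ m n k = trans (cong₂ ℤ._-_ (expand m) (expand n))
    (trans (lem₁ (+ c) (residue (eval g m) k) (residue (eval h m) k)
                       (residue (eval g n) k) (residue (eval h n) k))
    (trans (cong₂ (λ x y → x ℤ.- + c ℤ.* y) (eval-slope g m n k) (eval-slope h m n k))
      (lem₂ (+ c) (residue m k ℤ.- residue n k)
        (residue (slope g m n) k) (residue (slope h m n) k))))
    where
    expand : ∀ x → residue (eval (g -ₓ map μ h) x) k ≡
                   residue (eval g x) k ℤ.- + c ℤ.* residue (eval h x) k
    expand x = trans (eval-ₓ g (map μ h) x k)
      (cong (λ y → residue (eval g x) k ℤ.- y) (eval-map (+ c) {μ} (λ b → μ≡ b k) h x))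

    lem₁ : ∀ c x y x′ y′ → (x ℤ.- c ℤ.* y) ℤ.- (x′ ℤ.- c ℤ.* y′) ≡ (x ℤ.- x′) ℤ.- c ℤ.* (y ℤ.- y′)
    lem₁ = solve-∀
    lem₂ : ∀ c d s t → d ℤ.* s ℤ.- c ℤ.* (d ℤ.* t) ≡ d ℤ.* (s ℤ.- c ℤ.* t)
    lem₂ = solve-∀

  -- Functions with a slope on a residue class.

  module _ (r : Fin p) where

    private
      r̂ : ℤₚ
      r̂ = fromℕ (toℕ r)

      r̂∈ : r̂ ∈ r +pℤₚ
      r̂∈ = record { quotient = 0# ; equality = ≈-reflexive λ _ → sym (ℤ.+-inverseʳ (+ toℕ r)) }

    fromℤ-∈ : ∀ z → + p ℤ.∣ z ℤ.- + toℕ r → fromℤ z ∈ r +pℤₚ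
    fromℤ-∈ z (ℤ.divides s e) = record
      { quotient = fromℤ s ; equality = mk≈ λ _ → modℤ-reflexive (sym e) }

    residue-class : ∀ {k} n → 1 ≤ k → n ∈ r +pℤₚ → residue n k ≡ + toℕ r [modℤ p ]
    residue-class n 1≤k n∈ = modℤ (∣⇒∣residue (p∣p^ p 1≤k) n∈)

    -- For k = 0 the modulus is 1; for k = 1 both sides reduce to r. This is what makes the case k ≤
    -- 1 immediate.
    class-mod-p^ : ∀ {k} m n → k ≤ 1 → m ∈ r +pℤₚ → n ∈ r +pℤₚ →
                   residue m k ≡ residue n k [modℤ p ℕ.^ k ]
    class-mod-p^ {zero} m n _ _ _ =
      modℤ (ℤ.divides (residue m 0 ℤ.- residue n 0) (sym (ℤ.*-identityʳ _)))
    class-mod-p^ {suc zero} m n _ m∈ n∈ = subst (residue m 1 ≡ residue n 1 [modℤ_]) (sym (ℕ.^-identityʳ p))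
      (modℤ-trans (residue-class m ℕ.≤-refl m∈) (modℤ-sym (residue-class n ℕ.≤-refl n∈)))
    class-mod-p^ {suc (suc _)} _ _ (s≤s ()) _ _

    -- φ (m) − φ (n) = (m − n) S (m, n) up to a unit factor.
    record HasSlope (φ : ℤₚ → ℤₚ) (S : ℤₚ → ℤₚ → ℤₚ) : Set where
      no-eta-equality
      field
        slope⇔ : ∀ k m n → m ∈ r +pℤₚ → n ∈ r +pℤₚ →
          residue (φ m) k ≡ residue (φ n) k [modℤ p ℕ.^ k ] ⇔
          + (p ℕ.^ k) ℤ.∣ (residue m k ℤ.- residue n k) ℤ.* residue (S m n) k

    open HasSlope

    module _ {φ : ℤₚ → ℤₚ} {S : ℤₚ → ℤₚ → ℤₚ} (φ-slope : HasSlope φ S) where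

      slope⇒mod-p^ : ∀ k m n → m ∈ r +pℤₚ → n ∈ r +pℤₚ →
        residue m k ≡ residue n k [modℤ p ℕ.^ k ] →
        residue (φ m) k ≡ residue (φ n) k [modℤ p ℕ.^ k ]
      slope⇒mod-p^ k m n m∈ n∈ (modℤ e) =
        Equivalence.from (slope⇔ φ-slope k m n m∈ n∈) (ℤ.∣m⇒∣m*n (residue (S m n) k) e)

      -- Modulo p the class is a single point, so `φ` is constant on it modulo p.
      slope⇒%p : ∀ m n → m ∈ r +pℤₚ → n ∈ r +pℤₚ → φ m %p ≡ φ n %p
      slope⇒%p m n m∈ n∈ = %ℕ-cong p
        (subst (residue (φ m) 1 ≡ residue (φ n) 1 [modℤ_]) (ℕ.^-identityʳ p)
          (slope⇒mod-p^ 1 m n m∈ n∈ (class-mod-p^ m n ℕ.≤-refl m∈ n∈)))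

      slope⇒dropDigit⇔ : ∀ k m n → m ∈ r +pℤₚ → n ∈ r +pℤₚ →
        + (p ℕ.^ k) ℤ.∣ residue (dropDigit (φ m) - dropDigit (φ n)) k ⇔
        + (p ℕ.^ k) ℤ.∣ (residue m k ℤ.- residue n k) ℤ.* residue (S m n) k
      slope⇒dropDigit⇔ k m n m∈ n∈ =
        mk⇔ (λ d → Equivalence.to (slope⇔ φ-slope k m n m∈ n∈) (Equivalence.to cancel (modℤ d)))
            (λ d → n∣a-b (Equivalence.from cancel (Equivalence.from (slope⇔ φ-slope k m n m∈ n∈) d)))
        where
        cancel : residue (φ m) k ℤ.- + (φ m %p) ≡ residue (φ n) k ℤ.- + (φ n %p) [modℤ p ℕ.^ k ] ⇔
                 residue (φ m) k ≡ residue (φ n) k [modℤ p ℕ.^ k ]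
        cancel = modℤ-cancel-- (cong +_ (slope⇒%p m n m∈ n∈))

    -- Suitability in terms of the slope.

    Reflects : (ℤₚ → ℤₚ → ℤₚ) → ℕ → Set
    Reflects S k = ∀ m n → m ∈ r +pℤₚ → n ∈ r +pℤₚ →
      + (p ℕ.^ k) ℤ.∣ (residue m k ℤ.- residue n k) ℤ.* residue (S m n) k →
      + (p ℕ.^ k) ℤ.∣ residue m k ℤ.- residue n k

    module _ {f : Func setoid setoid} {S : ℤₚ → ℤₚ → ℤₚ} (f-slope : HasSlope (Func.to f) S) where

      slope⇒weaklySuitable : ∀ k → WeaklySuitable r f k
      slope⇒weaklySuitable k m n m∈ n∈ m≡n = p^∣residue⇒p^∣ {k}
        (Equivalence.from (slope⇒dropDigit⇔ f-slope k m n m∈ n∈)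
          (ℤ.∣m⇒∣m*n (residue (S m n) k) (p^∣⇒p^∣residue k m≡n)))

      slope⇒suitable-≤1 : ∀ k → k ≤ 1 → Suitable r f k
      slope⇒suitable-≤1 k k≤1 m n m∈ n∈ = mk⇔ (slope⇒weaklySuitable k m n m∈ n∈)
        (λ _ → p^∣residue⇒p^∣ {k} (n∣a-b (class-mod-p^ m n k≤1 m∈ n∈)))

      -- One implication of suitability is weak suitability, which the slope provides. What remains
      -- is the converse, and `slope⇒dropDigit⇔` turns it into `Reflects`.
      suitable⇔reflects : ∀ k → Suitable r f k ⇔ Reflects S k
      suitable⇔reflects k = mk⇔
        (λ suit m n m∈ n∈ d → p^∣⇒p^∣residue k (Equivalence.from (suit m n m∈ n∈)
          (p^∣residue⇒p^∣ {k} (Equivalence.from (slope⇒dropDigit⇔ f-slope k m n m∈ n∈) d))))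
        (λ reflects m n m∈ n∈ → mk⇔ (slope⇒weaklySuitable k m n m∈ n∈)
          (λ e → p^∣residue⇒p^∣ {k} (reflects m n m∈ n∈
            (Equivalence.to (slope⇒dropDigit⇔ f-slope k m n m∈ n∈) (p^∣⇒p^∣residue k e)))))

    -- Since `S` is constant modulo p, its value at (r, r) decides. A regular value can be cancelled
    -- modulo pᵏ; conversely, pairs differing by a multiple of pᵏ⁻¹ detect zero divisors.
    reflects⇔regular : ∀ S k → 2 ≤ k →
      (∀ m n → m ∈ r +pℤₚ → n ∈ r +pℤₚ → residue (S m n) k ≡ residue (S r̂ r̂) k [modℤ p ]) →
      Reflects S k ⇔ RegularMod p (residue (S r̂ r̂) k)
    reflects⇔regular S (suc j) (s≤s 1≤j) S-const = mk⇔ reflects⇒regular regular⇒reflects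
      where
      k = suc j
      α = residue (S r̂ r̂) k

      regular⇒reflects : RegularMod p α → Reflects S k
      regular⇒reflects reg m n m∈ n∈ =
        RegularMod-cancel-^ p (RegularMod-cong (modℤ-sym (S-const m n m∈ n∈)) reg) k
          (residue m k ℤ.- residue n k)

      reflects⇒regular : Reflects S k → RegularMod p α
      reflects⇒regular reflects t p∣tα =
        -- From p ∣ t α and S(m, r) ≡ α follows pᵏ ∣ pʲ t S(m, r), where m - r = pʲ t. Reflection
        -- gives pᵏ ∣ pʲ t, and cancelling pʲ leaves p ∣ t.
        ^-suc∣⇒∣ p j (subst (+ (p ℕ.^ k) ℤ.∣_) (lem₁ (+ toℕ r) (q ℤ.* t))
          (reflects m r̂ m∈ r̂∈ (subst (+ (p ℕ.^ k) ℤ.∣_) (lem₂ (+ toℕ r) q t (residue (S m r̂) k))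
            (∣⇒^-suc∣ p j (∣-modℤ (modℤ-* {a = t} modℤ-refl (S-const m r̂ m∈ r̂∈)) p∣tα)))))
        where
        q = + (p ℕ.^ j)

        lem₁ : ∀ r x → (r ℤ.+ x) ℤ.- r ≡ x
        lem₁ = solve-∀
        lem₂ : ∀ r q t s → q ℤ.* (t ℤ.* s) ≡ ((r ℤ.+ q ℤ.* t) ℤ.- r) ℤ.* s
        lem₂ = solve-∀

        m : ℤₚ
        m = fromℤ (+ toℕ r ℤ.+ q ℤ.* t)

        m∈ : m ∈ r +pℤₚ
        -- Here k ≥ 2 enters: j = k - 1 ≥ 1, so p ∣ pʲ and `m` stays in the class of r.
        m∈ = fromℤ-∈ (+ toℕ r ℤ.+ q ℤ.* t) (subst (+ p ℤ.∣_) (sym (lem₁ (+ toℕ r) (q ℤ.* t)))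
          (ℤ.∣m⇒∣m*n t (p∣p^ p 1≤j)))

    linear-slope-const : ∀ c g h {k} m n → 1 ≤ k → m ∈ r +pℤₚ → n ∈ r +pℤₚ →
      residue (linear-slope c g h m n) k ≡ residue (linear-slope c g h r̂ r̂) k [modℤ p ]
    linear-slope-const c g h {k} m n 1≤k m∈ n∈ = modℤ-+ (const g)
      (modℤ-neg (modℤ-* {a = + c} modℤ-refl (const h)))
      where
      const : ∀ g → residue (slope g m n) k ≡ residue (slope g r̂ r̂) k [modℤ p ]
      const g = slope-modℤ g m n r̂ r̂ k (residue-class m 1≤k m∈) (residue-class n 1≤k n∈)

    linear-hasSlope : ∀ {c g h μ} → (∀ b k → residue (μ b) k ≡ + c ℤ.* residue b k) →
      HasSlope (eval (g -ₓ map μ h)) (linear-slope c g h)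
    slope⇔ (linear-hasSlope {c} {g} {h} {μ} μ≡) k m n _ _ = mk⇔
      (subst (+ (p ℕ.^ k) ℤ.∣_) (eval-linear-slope c g h {μ} μ≡ m n k) ∘ n∣a-b)
      (modℤ ∘ subst (+ (p ℕ.^ k) ℤ.∣_) (sym (eval-linear-slope c g h {μ} μ≡ m n k)))

    -- The slope of a quotient of polynomials.

    -- f = g / h on the class, read off on residues with h⁻¹ n n∈ k an inverse of h(n) modulo pᵏ.
    module _ (f : ℤₚ → ℤₚ) (g h : ℤₚ[x])
      (h⁻¹ : ∀ n → n ∈ r +pℤₚ → ℕ → ℤ)
      (h*h⁻¹ : ∀ n n∈ k → residue (eval h n) k ℤ.* h⁻¹ n n∈ k ≡ + 1 [modℤ p ℕ.^ k ])
      (f≡g*h⁻¹ : ∀ n n∈ k →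
        residue (f n) k ≡ residue (eval g n) k ℤ.* h⁻¹ n n∈ k [modℤ p ℕ.^ k ])
      where

      h*f : ∀ n → n ∈ r +pℤₚ → ∀ k →
            residue (eval h n) k ℤ.* residue (f n) k ≡ residue (eval g n) k [modℤ p ℕ.^ k ]
      h*f n n∈ k = modℤ-trans (modℤ-* {a = H} modℤ-refl (f≡g*h⁻¹ n n∈ k))
        (modℤ-trans (modℤ-reflexive (lem H G (h⁻¹ n n∈ k)))
        (modℤ-trans (modℤ-* {a = G} modℤ-refl (h*h⁻¹ n n∈ k)) (modℤ-reflexive (ℤ.*-identityʳ G))))
        where
        H = residue (eval h n) k
        G = residue (eval g n) k
        lem : ∀ h g e → h ℤ.* (g ℤ.* e) ≡ g ℤ.* (h ℤ.* e)
        lem = solve-∀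

      -- The cofactor of m - n in g(m) h(n) - g(n) h(m), found by inserting g(n) h(n).
      quotient-slope : ℤₚ → ℤₚ → ℤₚ
      quotient-slope m n = slope g m n * eval h n - eval g n * slope h m n

      -- The unit factor is h(m) h(n): multiplying f(m) - f(n) by it clears the denominators, and it
      -- can be cancelled again modulo pᵏ.
      quotient-hasSlope : HasSlope f quotient-slope
      slope⇔ quotient-hasSlope k m n m∈ n∈ = mk⇔
        (λ e → ∣-modℤ (modℤ-sym key) (ℤ.∣n⇒∣m*n Hm (ℤ.∣n⇒∣m*n Hn (n∣a-b e))))
        (λ d → modℤ (unit-cancel-∣ Hn _ _ (h*h⁻¹ n n∈ k)
          (unit-cancel-∣ Hm _ _ (h*h⁻¹ m m∈ k) (∣-modℤ key d))))
        where
        Hm = residue (eval h m) k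
        Hn = residue (eval h n) k
        Gm = residue (eval g m) k
        Gn = residue (eval g n) k
        Fm = residue (f m) k
        Fn = residue (f n) k
        D  = residue m k ℤ.- residue n k

        lem₁ : ∀ a b x y → a ℤ.* (b ℤ.* (x ℤ.- y)) ≡ (a ℤ.* x) ℤ.* b ℤ.- (b ℤ.* y) ℤ.* a
        lem₁ = solve-∀
        lem₂ : ∀ a b x y → x ℤ.* b ℤ.- y ℤ.* a ≡ (x ℤ.- y) ℤ.* b ℤ.- y ℤ.* (a ℤ.- b)
        lem₂ = solve-∀
        lem₃ : ∀ b y d s t → (d ℤ.* s) ℤ.* b ℤ.- y ℤ.* (d ℤ.* t) ≡ d ℤ.* (s ℤ.* b ℤ.- y ℤ.* t)
        lem₃ = solve-∀

        key : Hm ℤ.* (Hn ℤ.* (Fm ℤ.- Fn)) ≡ D ℤ.* residue (quotient-slope m n) k [modℤ p ℕ.^ k ]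
        key = modℤ-trans (modℤ-reflexive (lem₁ Hm Hn Fm Fn))
          (modℤ-trans (modℤ-+ (modℤ-* {c = Hn} (h*f m m∈ k) modℤ-refl)
                              (modℤ-neg (modℤ-* {c = Hm} (h*f n n∈ k) modℤ-refl)))
          (modℤ-reflexive (trans (lem₂ Hm Hn Gm Gn)
            (trans (cong₂ (λ x y → x ℤ.* Hn ℤ.- Gn ℤ.* y) (eval-slope g m n k) (eval-slope h m n k))
              (lem₃ Hn Gn D (residue (slope g m n) k) (residue (slope h m n) k))))))

      quotient-slope-const : ∀ {k} m n → 1 ≤ k → m ∈ r +pℤₚ → n ∈ r +pℤₚ →
        residue (quotient-slope m n) k ≡ residue (quotient-slope r̂ r̂) k [modℤ p ]
      quotient-slope-const {k} m n 1≤k m∈ n∈ = modℤ-+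
        (modℤ-* (const g) (eval-modℤ h n r̂ k n≡r))
        (modℤ-neg (modℤ-* (eval-modℤ g n r̂ k n≡r) (const h)))
        where
        n≡r = residue-class n 1≤k n∈
        const : ∀ g → residue (slope g m n) k ≡ residue (slope g r̂ r̂) k [modℤ p ]
        const g = slope-modℤ g m n r̂ r̂ k (residue-class m 1≤k m∈) n≡r

      -- Modulo p, g(r) ≡ h(r) d with d = f(r) % p. Substituting this lets h(r) factor out of both
      -- terms, which is why the polynomial g - d h appears.
      quotient-slope≡h*linear-slope : ∀ {k} → 1 ≤ k →
        residue (quotient-slope r̂ r̂) k ≡
        residue (eval h r̂) k ℤ.* residue (linear-slope (f r̂ %p) g h r̂ r̂) k [modℤ p ]
      quotient-slope≡h*linear-slope {k} 1≤k = modℤ-trans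
        (modℤ-+ {a = sg ℤ.* H} modℤ-refl (modℤ-neg (modℤ-* {c = sh} G≡Hd modℤ-refl)))
        (modℤ-reflexive (lem H (+ (f r̂ %p)) sg sh))
        where
        H  = residue (eval h r̂) k
        sg = residue (slope g r̂ r̂) k
        sh = residue (slope h r̂ r̂) k

        G≡Hd : residue (eval g r̂) k ≡ H ℤ.* + (f r̂ %p) [modℤ p ]
        G≡Hd = modℤ-trans (modℤ-sym (modℤ-∣ (p∣p^ p 1≤k) (h*f r̂ r̂∈ k)))
          (modℤ-* {a = H} modℤ-refl (residue-%p (f r̂) 1≤k))

        lem : ∀ h d s t → s ℤ.* h ℤ.- (h ℤ.* d) ℤ.* t ≡ h ℤ.* (s ℤ.- d ℤ.* t)
        lem = solve-∀

      -- Both sides amount to regularity modulo p of the slope at (r, r), and these two values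
      -- differ by the unit h(r).
      reflects-quotient⇔linear : ∀ k → 2 ≤ k →
        Reflects quotient-slope k ⇔ Reflects (linear-slope (f r̂ %p) g h) k
      reflects-quotient⇔linear k 2≤k =
        ⇔-sym linear-regular ⇔-∘ (regular-unit ⇔-∘ (regular-cong ⇔-∘ quotient-regular))
        where
        1≤k : 1 ≤ k
        1≤k = ℕ.≤-trans (s≤s z≤n) 2≤k

        H α β : ℤ
        H = residue (eval h r̂) k
        α = residue (quotient-slope r̂ r̂) k
        β = residue (linear-slope (f r̂ %p) g h r̂ r̂) k

        α≡Hβ : α ≡ H ℤ.* β [modℤ p ]
        α≡Hβ = quotient-slope≡h*linear-slope 1≤k

        quotient-regular : Reflects quotient-slope k ⇔ RegularMod p α
        quotient-regular = reflects⇔regular quotient-slope k 2≤k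
          (λ m n → quotient-slope-const {k} m n 1≤k)

        linear-regular : Reflects (linear-slope (f r̂ %p) g h) k ⇔ RegularMod p β
        linear-regular = reflects⇔regular (linear-slope (f r̂ %p) g h) k 2≤k
          (λ m n → linear-slope-const (f r̂ %p) g h {k} m n 1≤k)

        regular-cong : RegularMod p α ⇔ RegularMod p (H ℤ.* β)
        regular-cong = mk⇔ (RegularMod-cong α≡Hβ) (RegularMod-cong (modℤ-sym α≡Hβ))

        regular-unit : RegularMod p (H ℤ.* β) ⇔ RegularMod p β
        regular-unit = RegularMod-unit H (h⁻¹ r̂ r̂∈ k) β
          (modℤ-∣ (p∣p^ p 1≤k) (h*h⁻¹ r̂ r̂∈ k))

-- Suitability of g - d h and the three claims.

module _ {p : ℕ} .{{_ : NonTrivial p}} where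
  open PAdic p

  -- Only implicit arguments occur in the result type, so that Agda solves μ from the goal before it
  -- checks the hypothesis on μ.
  linear-dropDigit⁺ : ∀ {r g h c m n k μ} → m ∈ r +pℤₚ → n ∈ r +pℤₚ →
    + (p ℕ.^ k) ℤ.∣ (residue m k ℤ.- residue n k) ℤ.* residue (linear-slope c g h m n) k →
    (∀ b k → residue (μ b) k ≡ + c ℤ.* residue b k) →
    + (p ℕ.^ k) ℤ.∣ residue (dropDigit (eval (g -ₓ map μ h) m) - dropDigit (eval (g -ₓ map μ h) n)) k
  linear-dropDigit⁺ {r} {g} {h} {c} {m} {n} {k} {μ} m∈ n∈ d μ≡ = Equivalence.from
    (slope⇒dropDigit⇔ r (linear-hasSlope r {c} {g} {h} {μ} μ≡) k m n m∈ n∈) d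

  linear-dropDigit⁻ : ∀ {r g h c m n k μ} → m ∈ r +pℤₚ → n ∈ r +pℤₚ →
    + (p ℕ.^ k) ℤ.∣ residue (dropDigit (eval (g -ₓ map μ h) m) - dropDigit (eval (g -ₓ map μ h) n)) k →
    (∀ b k → residue (μ b) k ≡ + c ℤ.* residue b k) →
    + (p ℕ.^ k) ℤ.∣ (residue m k ℤ.- residue n k) ℤ.* residue (linear-slope c g h m n) k
  linear-dropDigit⁻ {r} {g} {h} {c} {m} {n} {k} {μ} m∈ n∈ d μ≡ = Equivalence.to
    (slope⇒dropDigit⇔ r (linear-hasSlope r {c} {g} {h} {μ} μ≡) k m n m∈ n∈) d

theorem4p16 : (p : ℕ) .{{_ : NonTrivial p}} →
    let open PAdic p in
    (r : Fin p) (f : Func setoid setoid) (g h : ℤₚ[x])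
    (coprime : gcd p (eval h (fromℕ (toℕ r)) %p) ≡ 1) →
    (∀ n (n∈ : n ∈ r +pℤₚ) →
    Func.to f n ≈ eval g n / eval h n ⟨ coprime-on-class h r coprime n∈ ⟩) →
    (k : ℕ) →
    WeaklySuitable r f k ×
    (k ≤ 1 → Suitable r f k) ×
    (2 ≤ k →
    Suitable r f k ⇔
    Suitable r (polyFunc (g -ₓ fromℕ (Func.to f (fromℕ (toℕ r)) %p) ·ₓ h)) k)
theorem4p16 p r f g h coprime f≈g/h k =
  slope⇒weaklySuitable r {f} hasSlope k ,
  slope⇒suitable-≤1 r {f} hasSlope k ,
  λ 2≤k → ⇔-intro
    (λ suit m n m∈ n∈ → ⇔-intro
      -- This implication is weak suitability of the polynomial and comes from its slope; the
      -- converse carries `suit` over from f through `Reflects`.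
      (λ m≡n → p^∣residue⇒p^∣ {k = k} (linear-dropDigit⁺ {r = r} {g} {h} {d} {m} {n} {k} m∈ n∈
        (ℤ.∣m⇒∣m*n (residue (linear-slope d g h m n) k) (p^∣⇒p^∣residue k m≡n)) (λ _ _ → refl)))
      (λ e → p^∣residue⇒p^∣ {k = k} (Equivalence.to (reflects⇔ 2≤k)
        (Equivalence.to (suitable⇔reflects r {f} hasSlope k) suit) m n m∈ n∈
        (linear-dropDigit⁻ {r = r} {g} {h} {d} {m} {n} {k} m∈ n∈
          (p^∣⇒p^∣residue k e) (λ _ _ → refl)))))
    (λ suit → Equivalence.from (suitable⇔reflects r {f} hasSlope k)
      (Equivalence.from (reflects⇔ 2≤k) λ m n m∈ n∈ div →
        p^∣⇒p^∣residue k (Equivalence.from (suit m n m∈ n∈)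
          (p^∣residue⇒p^∣ {k = k} (linear-dropDigit⁺ {r = r} {g} {h} {d} {m} {n} {k} m∈ n∈
            div (λ _ _ → refl))))))
  where
  open PAdic p

  h-coprime : ∀ n → n ∈ r +pℤₚ → Coprime-p (eval h n)
  h-coprime n n∈ = coprime-on-class h r coprime {n} n∈

  h⁻¹ : ∀ n → n ∈ r +pℤₚ → ℕ → ℤ
  h⁻¹ n n∈ = residue (inverse (eval h n) (h-coprime n n∈))

  h*h⁻¹ : ∀ n n∈ k → residue (eval h n) k ℤ.* h⁻¹ n n∈ k ≡ + 1 [modℤ p ℕ.^ k ]
  h*h⁻¹ n n∈ = residue-≈ (*-inverse (eval h n) (h-coprime n n∈))

  f≡g*h⁻¹ : ∀ n n∈ k →
    residue (Func.to f n) k ≡ residue (eval g n) k ℤ.* h⁻¹ n n∈ k [modℤ p ℕ.^ k ]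
  f≡g*h⁻¹ n n∈ = residue-≈ (f≈g/h n n∈)

  hasSlope : HasSlope r (Func.to f) (quotient-slope r (Func.to f) g h h⁻¹ h*h⁻¹ f≡g*h⁻¹)
  hasSlope = quotient-hasSlope r (Func.to f) g h h⁻¹ h*h⁻¹ f≡g*h⁻¹

  d : ℕ
  d = Func.to f (fromℕ (toℕ r)) %p

  reflects⇔ : 2 ≤ k →
    Reflects r (quotient-slope r (Func.to f) g h h⁻¹ h*h⁻¹ f≡g*h⁻¹) k ⇔ Reflects r (linear-slope d g h) k
  reflects⇔ = reflects-quotient⇔linear r (Func.to f) g h h⁻¹ h*h⁻¹ f≡g*h⁻¹ k
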